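{- Let $D=(V,A)$ be a finite simple digraph and let $G=Z(D)$ be its Z-mapping graph. If $D$ contains a Hamiltonian cycle $L$ (viewed as a set of arcs), then $G$ contains a perfect matching $M$, where $M=F(L)$ is the image of $L$ under the map $F$ sending each arc $\langle v_i,v_j\rangle\in A$ to the edge $(v_i^+,v_j^-)$ of $G$.
   Context: All graphs and digraphs are finite and simple: no multiple edges or arcs and no self-loops (a digraph may contain both $\langle u,v\rangle$ and $\langle v,u\rangle$). For a digraph $D=(V,A)$ with $V=\{v_1,\dots,v_n\}$, the Z-mapping graph $Z(D)$ is the balanced bipartite (undirected) graph $G(V^+,V^-;E)$ with parts $V^+=\{v_1^+,\dots,v_n^+\}$ and $V^-=\{v_1^-,\dots,v_n^-\}$ and edge set $E=\{(v_i^+,v_j^-) : \langle v_i,v_j\rangle\in A\}$. A Hamiltonian cycle of a digraph is a simple directed cycle through all its vertices, identified with its set of arcs. -}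

module Defs where

open import Data.Fin.Base using (Fin; toℕ)
open import Data.Fin.Properties using (any?) renaming (_≟_ to _≟ᶠ_)
open import Data.Nat.Base using (ℕ; suc; NonZero)
open import Data.Nat.DivMod using (_mod_)
open import Data.Product.Base using (_×_; _,_; ∃; ∃₂; proj₁; proj₂)
open import Data.Product.Properties using (≡-dec)
open import Data.Sum.Base using (_⊎_; inj₁; inj₂)
open import Function.Definitions using (Injective; StrictlySurjective)
open import Level using (0ℓ)
open import Relation.Binary.Definitions using (DecidableEquality)
open import Relation.Binary.PropositionalEquality.Core using (_≡_; refl; cong)
open import Relation.Nullary.Decidable using (_×-dec_; map′)
open import Relation.Unary using (Pred; Decidable; _∈_; _∉_; _⊆_; _≐_)

-- The vertex v_i is the element i of Fin n.  The arc set A is a set of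
-- ordered pairs, so there are no multiple arcs; decidability makes it a
-- finite set constructively.
record Digraph (n : ℕ) : Set₁ where
  field
    A       : Pred (Fin n × Fin n) 0ℓ
    A?      : Decidable A
    no-loop : ∀ v → (v , v) ∉ A

-- A simple directed cycle vertex 0 → vertex 1 → … → vertex (length - 1) →
-- vertex 0.  The empty cycle is ruled out by NonZero, and a cycle of length
-- one by the absence of loops; length two is allowed.
record Cycle {n : ℕ} (D : Digraph n) : Set where
  open Digraph D
  field
    length        : ℕ
    .{{nonZero}}  : NonZero length
    vertex        : Fin length → Fin n
    simple        : Injective _≡_ _≡_ vertex

  next : Fin length → Fin length
  next i = suc (toℕ i) mod length

  arc : Fin length → Fin n × Fin n
  arc i = vertex i , vertex (next i)

  field
    arc∈A : ∀ i → arc i ∈ A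

  arcs : Pred (Fin n × Fin n) 0ℓ
  arcs a = ∃ λ i → a ≡ arc i

IsHamiltonianCycle : ∀ {n} → Digraph n → Pred (Fin n × Fin n) 0ℓ → Set
IsHamiltonianCycle D L =
  ∃ λ (C : Cycle D) → StrictlySurjective _≡_ (Cycle.vertex C) × L ≐ Cycle.arcs C

data V⁺ (n : ℕ) : Set where
  _⁺ : Fin n → V⁺ n

data V⁻ (n : ℕ) : Set where
  _⁻ : Fin n → V⁻ n

-- Every edge joins the two parts, so an undirected edge is determined by the
-- pair of its V⁺-endpoint and its V⁻-endpoint, with no orientation implied.
record BipartiteGraph (p q : ℕ) : Set₁ where
  field
    E  : Pred (V⁺ p × V⁻ q) 0ℓ
    E? : Decidable E

module _ {p q : ℕ} where

  Incident : V⁺ p ⊎ V⁻ q → V⁺ p × V⁻ q → Set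
  Incident (inj₁ x) e = x ≡ proj₁ e
  Incident (inj₂ y) e = y ≡ proj₂ e

  record IsMatching (G : BipartiteGraph p q)
                    (M : Pred (V⁺ p × V⁻ q) 0ℓ) : Set where
    open BipartiteGraph G
    field
      M⊆E      : M ⊆ E
      disjoint : ∀ {e f} → e ∈ M → f ∈ M →
                 ∀ v → Incident v e → Incident v f → e ≡ f

  record IsPerfectMatching (G : BipartiteGraph p q)
                           (M : Pred (V⁺ p × V⁻ q) 0ℓ) : Set where
    field
      isMatching : IsMatching G M
      covers     : ∀ v → ∃ λ e → e ∈ M × Incident v e

_≟⁺_ : ∀ {n} → DecidableEquality (V⁺ n)
(i ⁺) ≟⁺ (j ⁺) = map′ (cong _⁺) (λ { refl → refl }) (i ≟ᶠ j)

_≟⁻_ : ∀ {n} → DecidableEquality (V⁻ n)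
(i ⁻) ≟⁻ (j ⁻) = map′ (cong _⁻) (λ { refl → refl }) (i ≟ᶠ j)

Z : ∀ {n} → Digraph n → BipartiteGraph n n
Z D = record
  { E  = λ e → ∃₂ λ i j → (i , j) ∈ A × e ≡ (i ⁺ , j ⁻)
  ; E? = λ e → any? λ i → any? λ j →
           A? (i , j) ×-dec ≡-dec _≟⁺_ _≟⁻_ e (i ⁺ , j ⁻)
  }
  where open Digraph D

-- Defined on all ordered pairs of vertices; on A it takes values in the edge
-- set of Z D.
F : ∀ {n} → Fin n × Fin n → V⁺ n × V⁻ n
F (i , j) = i ⁺ , j ⁻

F[_] : ∀ {n} → Pred (Fin n × Fin n) 0ℓ → Pred (V⁺ n × V⁻ n) 0ℓ
F[ L ] e = ∃ λ a → a ∈ L × e ≡ F a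

{-# OPTIONS --safe #-}
-- Cyclic succession on the indices of a cycle is a bijection.  Hence every
-- vertex of a Hamiltonian cycle is the tail of exactly one of its arcs and the
-- head of exactly one, which is what it means for F[ L ] to meet each v⁺ and
-- each v⁻ exactly once.
module Submission where

open import Defs
open import Data.Fin.Base using (Fin; zero; suc; toℕ; fromℕ; inject₁)
open import Data.Fin.Properties
  using (toℕ-injective; toℕ-fromℕ; toℕ-fromℕ<; toℕ-inject₁; toℕ<n)
open import Data.Fin.Relation.Unary.Top using (view; ‵fromℕ; ‵inject₁)
open import Data.Nat.Base using (ℕ; suc; NonZero; s≤s)
open import Data.Nat.DivMod using (_mod_; _%_; m%n<n; n%n≡0; m<n⇒m%n≡m)
open import Data.Product.Base using (_×_; _,_; ∃; proj₁; proj₂)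
open import Data.Sum.Base using (inj₁; inj₂)
open import Function.Definitions using (Injective; StrictlySurjective)
open import Level using (0ℓ)
open import Relation.Binary.PropositionalEquality
  using (_≡_; refl; sym; trans; cong; module ≡-Reasoning)
open import Relation.Unary using (Pred; _∈_)

toℕ-mod : ∀ m n .{{_ : NonZero n}} → toℕ (m mod n) ≡ m % n
toℕ-mod m n = toℕ-fromℕ< (m%n<n m n)

-- The map `Cycle.next`, stated for an arbitrary modulus; the two agree by unfolding, so facts
-- proved here apply directly to a cycle's arcs.
cyclicSuc : ∀ {n} .{{_ : NonZero n}} → Fin n → Fin n
cyclicSuc {n} i = suc (toℕ i) mod n

-- Given by cases rather than by `mod`: the wrap-around at `zero` and the plain step are then
-- separate equations, one for each lemma below.
cyclicPred : ∀ {n} → Fin n → Fin n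
cyclicPred zero    = fromℕ _
cyclicPred (suc i) = inject₁ i

cyclicSuc-fromℕ : ∀ n → cyclicSuc (fromℕ n) ≡ zero
cyclicSuc-fromℕ n = toℕ-injective (begin
  toℕ (cyclicSuc (fromℕ n))    ≡⟨ toℕ-mod (suc (toℕ (fromℕ n))) (suc n) ⟩
  suc (toℕ (fromℕ n)) % suc n  ≡⟨ cong (λ k → suc k % suc n) (toℕ-fromℕ n) ⟩
  suc n % suc n                ≡⟨ n%n≡0 (suc n) ⟩
  0                            ∎)
  where open ≡-Reasoning

cyclicSuc-inject₁ : ∀ {n} (i : Fin n) → cyclicSuc (inject₁ i) ≡ suc i
cyclicSuc-inject₁ {n} i = toℕ-injective (begin
  toℕ (cyclicSuc (inject₁ i))    ≡⟨ toℕ-mod (suc (toℕ (inject₁ i))) (suc n) ⟩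
  suc (toℕ (inject₁ i)) % suc n  ≡⟨ cong (λ k → suc k % suc n) (toℕ-inject₁ i) ⟩
  suc (toℕ i) % suc n            ≡⟨ m<n⇒m%n≡m (s≤s (toℕ<n i)) ⟩
  suc (toℕ i)                    ∎)
  where open ≡-Reasoning

cyclicSuc-cyclicPred : ∀ {n} .{{_ : NonZero n}} (i : Fin n) →
  cyclicSuc (cyclicPred i) ≡ i
cyclicSuc-cyclicPred zero    = cyclicSuc-fromℕ _
cyclicSuc-cyclicPred (suc i) = cyclicSuc-inject₁ i

cyclicPred-cyclicSuc : ∀ {n} .{{_ : NonZero n}} (i : Fin n) →
  cyclicPred (cyclicSuc i) ≡ i
-- Wrap-around happens at the last index, which matching on `zero` and `suc` does not isolate; the
-- view splits it off from the rest.
cyclicPred-cyclicSuc {suc n} i with view i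
... | ‵fromℕ     = cong cyclicPred (cyclicSuc-fromℕ n)
... | ‵inject₁ j = cong cyclicPred (cyclicSuc-inject₁ j)

cyclicSuc-injective : ∀ {n} .{{_ : NonZero n}} →
  Injective _≡_ _≡_ (cyclicSuc {n})
cyclicSuc-injective {x = i} {y = j} eq =
  trans (sym (cyclicPred-cyclicSuc i))
        (trans (cong cyclicPred eq) (cyclicPred-cyclicSuc j))

⁺-injective : ∀ {n} {i j : Fin n} → i ⁺ ≡ j ⁺ → i ≡ j
⁺-injective refl = refl

⁻-injective : ∀ {n} {i j : Fin n} → i ⁻ ≡ j ⁻ → i ≡ j
⁻-injective refl = refl

module _ {n} {D : Digraph n} (C : Cycle D) where
  open Cycle C

  tail-injective : ∀ {i j} → proj₁ (F (arc i)) ≡ proj₁ (F (arc j)) → i ≡ j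
  tail-injective eq = simple (⁺-injective eq)

  head-injective : ∀ {i j} → proj₂ (F (arc i)) ≡ proj₂ (F (arc j)) → i ≡ j
  -- The head of arc `i` is the vertex at position `next i`, so simplicity only identifies
  -- successors; injectivity of the cyclic successor then identifies the indices.
  head-injective eq = cyclicSuc-injective (simple (⁻-injective eq))

  head-surjective : StrictlySurjective _≡_ vertex →
                    StrictlySurjective _≡_ (λ i → proj₂ (arc i))
  head-surjective onto v with onto v
  -- The arc entering the vertex at position `i` starts one position earlier.
  ... | i , refl = cyclicPred i , cong vertex (cyclicSuc-cyclicPred i)

theorem7 : ∀ {n : ℕ} (D : Digraph n) (L : Pred (Fin n × Fin n) 0ℓ) →
    IsHamiltonianCycle D L → IsPerfectMatching (Z D) F[ L ]
theorem7 D L (C , onto , L⊆arcs , arcs⊆L) = record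
  { isMatching = record
    { M⊆E      = λ e∈M → let i , e≡ = index e∈M in _ , _ , arc∈A i , e≡
    ; disjoint = disjoint
    }
  ; covers = covers
  }
  where
  open Cycle C

  -- Edges are handled through positions on the cycle: `arc∈A` then puts them in the graph, and two
  -- edges agree once their positions do.
  index : ∀ {e} → e ∈ F[ L ] → ∃ λ i → e ≡ F (arc i)
  index (a , a∈L , e≡Fa) with L⊆arcs a∈L
  ... | i , refl = i , e≡Fa

  F-arc∈ : ∀ i → F (arc i) ∈ F[ L ]
  F-arc∈ i = arc i , arcs⊆L (i , refl) , refl

  disjoint : ∀ {e f} → e ∈ F[ L ] → f ∈ F[ L ] →
             ∀ v → Incident v e → Incident v f → e ≡ f
  disjoint e∈M f∈M v v∈e v∈f with index e∈M | index f∈M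
  -- A shared endpoint in `V⁺` is a common tail, one in `V⁻` a common head; either forces equal
  -- positions.
  disjoint e∈M f∈M (inj₁ _) v∈e v∈f | i , refl | j , refl =
    cong (λ k → F (arc k)) (tail-injective C (trans (sym v∈e) v∈f))
  disjoint e∈M f∈M (inj₂ _) v∈e v∈f | i , refl | j , refl =
    cong (λ k → F (arc k)) (head-injective C (trans (sym v∈e) v∈f))

  covers : ∀ v → ∃ λ e → e ∈ F[ L ] × Incident v e
  covers (inj₁ (v ⁺)) =
    let i , eq = onto v in F (arc i) , F-arc∈ i , cong _⁺ (sym eq)
  covers (inj₂ (v ⁻)) =
    let i , eq = head-surjective C onto v in F (arc i) , F-arc∈ i , cong _⁻ (sym eq)
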